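{- For every integer $n\ge2$, $$\mathfrak{C}_n(x)=2x^2\,\mathfrak{C}_{n-2}(x)+\left(\frac x4+4x^3\right)\mathfrak{C}'_{n-2}(x)+\left(\frac{x^2}4+x^4\right)\mathfrak{C}''_{n-2}(x),$$ where primes denote derivatives with respect to $x$.
   Context: For $n\ge1$ the central factorial is $x^{[n]}=x\,(x+\tfrac n2-1)(x+\tfrac n2-2)\cdots(x-\tfrac n2+1)$ (a product of $n$ factors), and $x^{[0]}=1$. The central factorial numbers of the second kind $T(n,k)$ ($0\le k\le n$) are defined by $x^n=\sum_{k=0}^n T(n,k)\,x^{[k]}$; equivalently $T(n,k)=\frac1{k!}\sum_{j=0}^k(-1)^j\binom kj\left(\frac k2-j\right)^n$, and $T(n,k)=0$ for $k>n$. The $n$th central Fubini-like polynomial is $\mathfrak{C}_n(x)=\sum_{k=0}^n k!\,T(n,k)\,x^k$. -}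

module Defs where

open import Level using (0ℓ)
open import Algebra.Bundles.Raw using (RawSemiring)
import Algebra.Definitions.RawSemiring as RawSemiringDefs
open import Data.Fin.Base using (toℕ)
open import Data.Integer.Base using (+_)
open import Data.List.Base using (List; []; _∷_; map)
open import Data.Nat.Base as ℕ using (ℕ; zero; suc; _!)
open import Data.Rational.Base as ℚ using (ℚ; 0ℚ; 1ℚ; _/_)
open import Relation.Binary.PropositionalEquality.Core using (_≡_)

-- ℚ[x] as coefficient lists, lowest degree first.  Trailing zeros are allowed,
-- so polynomials are compared with _≈_ below and not with _≡_.
Poly : Set
Poly = List ℚ

coeff : Poly → ℕ → ℚ
coeff []      _       = 0ℚ
coeff (a ∷ p) zero    = a
coeff (a ∷ p) (suc i) = coeff p i

infix  4 _≈_
infixl 6 _+_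
infixl 7 _*_
infixr 8 _·_

_≈_ : Poly → Poly → Set
p ≈ q = ∀ i → coeff p i ≡ coeff q i

const : ℚ → Poly
const a = a ∷ []

X : Poly
X = 0ℚ ∷ 1ℚ ∷ []

_+_ : Poly → Poly → Poly
[]      + q       = q
(a ∷ p) + []      = a ∷ p
(a ∷ p) + (b ∷ q) = a ℚ.+ b ∷ p + q

_·_ : ℚ → Poly → Poly
a · p = map (a ℚ.*_) p

_*_ : Poly → Poly → Poly
[]      * q = []
(a ∷ p) * q = a · q + (0ℚ ∷ p * q)

polyRawSemiring : RawSemiring 0ℓ 0ℓ
polyRawSemiring = record
  { Carrier = Poly
  ; _≈_     = _≈_
  ; _+_     = _+_
  ; _*_     = _*_
  ; 0#      = []
  ; 1#      = const 1ℚ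
  }

open RawSemiringDefs polyRawSemiring public using (sum; product; _^_)

-- derivFrom m p is the derivative of xᵐ p, divided by xᵐ⁻¹ (for m ≥ 1).
derivFrom : ℕ → Poly → Poly
derivFrom m []      = []
derivFrom m (a ∷ p) = (+ m / 1) ℚ.* a ∷ derivFrom (suc m) p

deriv : Poly → Poly
deriv []      = []
deriv (a ∷ p) = derivFrom 1 p

-- For n = suc m the factors after x are x + n/2 - i with 1 ≤ i ≤ m = n - 1.
centralFactorial : ℕ → Poly
centralFactorial zero      = const 1ℚ
centralFactorial n@(suc m) =
  X * product {m} (λ i → X + const ((+ n / 2) ℚ.- (+ suc (toℕ i) / 1)))

-- T is the array of central factorial numbers of the second kind.  The central
-- factorials are monic with one in each degree, so T is determined uniquely.
record IsCentralFactorialNumbers (T : ℕ → ℕ → ℚ) : Set where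
  field
    expansion : ∀ n → X ^ n ≈ sum {suc n} (λ k → T n (toℕ k) · centralFactorial (toℕ k))
    vanishing : ∀ {n k} → n ℕ.< k → T n k ≡ 0ℚ

centralFubini : (ℕ → ℕ → ℚ) → ℕ → Poly
centralFubini T n =
  sum {suc n} (λ k → ((+ (toℕ k !) / 1) ℚ.* T n (toℕ k)) · X ^ toℕ k)

{-# OPTIONS --safe #-}
-- Consecutive central factorials of equal parity satisfy
-- x^[k+2] = (x² - k²/4) x^[k], because the product for k+2 is the one for k with
-- the two extra factors x + k/2 and x - k/2.  Multiplying the expansion of xⁿ by
-- x² and comparing coefficients in the basis x^[k] (monic, one in each degree)
-- gives T(n+2,k) = T(n,k-2) + k²/4 T(n,k).  Since the coefficient of xᵏ in ℭ_n is
-- k! T(n,k), the claim is this recurrence read off coefficientwise.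
module Submission where

open import Defs
open import Data.Integer.Base using (+_)
open import Data.Nat.Base using (ℕ; _≤_; _∸_)
open import Data.Rational.Base using (ℚ; _/_)

import Algebra.Properties.Semiring.Sum as SemiringSum
open import Algebra.Bundles using (CommutativeRing)
open import Algebra.Properties.AbelianGroup using (∙-cancelʳ)
open import Data.Fin.Base using (Fin; toℕ)
open import Data.Fin.Properties using (toℕ-inject₁; toℕ-fromℕ)
import Data.Integer.Base as ℤ
import Data.Integer.Properties as ℤ
open import Data.List.Base using ([]; _∷_)
open import Data.Nat.Base as ℕ using (zero; suc; _!; z≤n; s≤s)
import Data.Nat.Properties as ℕ
open import Data.Product.Base using (_×_; _,_; proj₁; proj₂)
open import Data.Rational.Base as ℚ using (0ℚ; 1ℚ; ½; fromℚᵘ)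
import Data.Rational.Properties as ℚ
open import Data.Rational.Solver using (module +-*-Solver)
open import Data.Rational.Unnormalised.Base as ℚᵘ using (mkℚᵘ; *≡*)
import Data.Rational.Unnormalised.Properties as ℚᵘ
open import Data.Sum.Base using (inj₁; inj₂)
open import Data.Vec.Functional using (Vector)
open import Function.Base using (_∘_)
open import Relation.Binary.PropositionalEquality
open import Relation.Nullary.Decidable using (yes; no)

open +-*-Solver using (solve; _:=_; _:+_; _:*_; _:-_; :-_; con)
open ≡-Reasoning

open SemiringSum (CommutativeRing.semiring ℚ.+-*-commutativeRing)
  using (sum-cong-≗; sum-replicate-zero; sum-init-last; ∑-distrib-+)
  renaming (sum to sumℚ)

-- Embedding of the natural numbers

-- `_/_` divides by a gcd, so identities between fractions with a variable numerator do not hold by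
-- computation. They are transferred from unnormalised rationals, where equality is
-- cross-multiplication.
fromℚᵘ-homo-+ : ∀ p q → fromℚᵘ (p ℚᵘ.+ q) ≡ fromℚᵘ p ℚ.+ fromℚᵘ q
fromℚᵘ-homo-+ p q = ℚ.toℚᵘ-injective
  (ℚᵘ.≃-trans (ℚ.toℚᵘ-fromℚᵘ (p ℚᵘ.+ q)) (ℚᵘ.≃-sym
    (ℚᵘ.≃-trans (ℚ.toℚᵘ-homo-+ (fromℚᵘ p) (fromℚᵘ q))
      (ℚᵘ.+-cong (ℚ.toℚᵘ-fromℚᵘ p) (ℚ.toℚᵘ-fromℚᵘ q)))))

fromℚᵘ-homo-* : ∀ p q → fromℚᵘ (p ℚᵘ.* q) ≡ fromℚᵘ p ℚ.* fromℚᵘ q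
fromℚᵘ-homo-* p q = ℚ.toℚᵘ-injective
  (ℚᵘ.≃-trans (ℚ.toℚᵘ-fromℚᵘ (p ℚᵘ.* q)) (ℚᵘ.≃-sym
    (ℚᵘ.≃-trans (ℚ.toℚᵘ-homo-* (fromℚᵘ p) (fromℚᵘ q))
      (ℚᵘ.*-cong (ℚ.toℚᵘ-fromℚᵘ p) (ℚ.toℚᵘ-fromℚᵘ q)))))

ι : ℕ → ℚ
ι n = + n / 1

ι-suc : ∀ n → ι (suc n) ≡ 1ℚ ℚ.+ ι n
ι-suc n = trans
  (ℚ.fromℚᵘ-cong {mkℚᵘ (+ suc n) 0} {mkℚᵘ (+ 1) 0 ℚᵘ.+ mkℚᵘ (+ n) 0}
    (*≡* (cong (λ z → (+ 1 ℤ.+ z) ℤ.* + 1) (sym (ℤ.*-identityʳ (+ n))))))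
  (fromℚᵘ-homo-+ (mkℚᵘ (+ 1) 0) (mkℚᵘ (+ n) 0))

ι-* : ∀ m n → ι (m ℕ.* n) ≡ ι m ℚ.* ι n
ι-* m n = trans
  (ℚ.fromℚᵘ-cong {mkℚᵘ (+ (m ℕ.* n)) 0} {mkℚᵘ (+ m) 0 ℚᵘ.* mkℚᵘ (+ n) 0}
    (*≡* (cong (ℤ._* + 1) (ℤ.pos-* m n))))
  (fromℚᵘ-homo-* (mkℚᵘ (+ m) 0) (mkℚᵘ (+ n) 0))

n/2≡½*n : ∀ n → + n / 2 ≡ ½ ℚ.* ι n
n/2≡½*n n = trans
  (ℚ.fromℚᵘ-cong {mkℚᵘ (+ n) 1} {mkℚᵘ (+ 1) 1 ℚᵘ.* mkℚᵘ (+ n) 0}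
    (*≡* (cong (ℤ._* + 2) (sym (ℤ.*-identityˡ (+ n))))))
  (fromℚᵘ-homo-* (mkℚᵘ (+ 1) 1) (mkℚᵘ (+ n) 0))

-- Coefficients

-- Multiplication by x on coefficient sequences. Identities of polynomials are proved as pointwise
-- identities of such sequences.
shift : (ℕ → ℚ) → ℕ → ℚ
shift f zero    = 0ℚ
shift f (suc i) = f i

shift-cong : ∀ {f g} → f ≗ g → shift f ≗ shift g
shift-cong f≗g zero    = refl
shift-cong f≗g (suc i) = f≗g i

shift-linear : ∀ b f g i →
  shift (λ j → b ℚ.* f j ℚ.+ g j) i ≡ b ℚ.* shift f i ℚ.+ shift g i
shift-linear b f g zero    = sym (trans (ℚ.+-identityʳ (b ℚ.* 0ℚ)) (ℚ.*-zeroʳ b))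
shift-linear b f g (suc i) = refl

shift-* : ∀ b f i → shift (λ j → b ℚ.* f j) i ≡ b ℚ.* shift f i
shift-* b f zero    = sym (ℚ.*-zeroʳ b)
shift-* b f (suc i) = refl

shift-sum : ∀ {n} (f : Fin n → ℕ → ℚ) i →
  shift (λ j → sumℚ (λ k → f k j)) i ≡ sumℚ (λ k → shift (f k) i)
shift-sum {n} f zero    = sym (sum-replicate-zero n)
shift-sum     f (suc i) = refl

coeff-0∷ : ∀ p → coeff (0ℚ ∷ p) ≗ shift (coeff p)
coeff-0∷ p zero    = refl
coeff-0∷ p (suc i) = refl

coeff-+ : ∀ p q i → coeff (p + q) i ≡ coeff p i ℚ.+ coeff q i
coeff-+ []      q       i       = sym (ℚ.+-identityˡ (coeff q i))
coeff-+ (a ∷ p) []      i       = sym (ℚ.+-identityʳ (coeff (a ∷ p) i))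
coeff-+ (a ∷ p) (b ∷ q) zero    = refl
coeff-+ (a ∷ p) (b ∷ q) (suc i) = coeff-+ p q i

coeff-· : ∀ a p i → coeff (a · p) i ≡ a ℚ.* coeff p i
coeff-· a []      i       = sym (ℚ.*-zeroʳ a)
coeff-· a (b ∷ p) zero    = refl
coeff-· a (b ∷ p) (suc i) = coeff-· a p i

coeff-∷* : ∀ a p q i →
  coeff ((a ∷ p) * q) i ≡ a ℚ.* coeff q i ℚ.+ shift (coeff (p * q)) i
coeff-∷* a p q i = trans (coeff-+ (a · q) (0ℚ ∷ p * q) i)
  (cong₂ ℚ._+_ (coeff-· a q i) (coeff-0∷ (p * q) i))

coeff-0∷* : ∀ p q i → coeff ((0ℚ ∷ p) * q) i ≡ shift (coeff (p * q)) i
coeff-0∷* p q i = trans (coeff-∷* 0ℚ p q i)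
  (trans (cong (ℚ._+ shift (coeff (p * q)) i) (ℚ.*-zeroˡ (coeff q i)))
    (ℚ.+-identityˡ _))

coeff-const* : ∀ a q i → coeff (const a * q) i ≡ a ℚ.* coeff q i
coeff-const* a q i = trans (coeff-∷* a [] q i)
  (trans (cong (a ℚ.* coeff q i ℚ.+_) (shift-zero i)) (ℚ.+-identityʳ _))
  where
  shift-zero : ∀ j → shift (coeff []) j ≡ 0ℚ
  shift-zero zero    = refl
  shift-zero (suc j) = refl

coeff-sum : ∀ {n} (p : Vector Poly n) i → coeff (sum p) i ≡ sumℚ (λ k → coeff (p k) i)
coeff-sum {zero}  p i = refl
coeff-sum {suc n} p i = trans (coeff-+ (p Fin.zero) (sum (p ∘ Fin.suc)) i)
  (cong (coeff (p Fin.zero) i ℚ.+_) (coeff-sum (p ∘ Fin.suc) i))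

coeff-linearCombination : ∀ N (a : ℕ → ℚ) (p : ℕ → Poly) i →
  coeff (sum {N} (λ k → a (toℕ k) · p (toℕ k))) i
    ≡ sumℚ {N} (λ k → a (toℕ k) ℚ.* coeff (p (toℕ k)) i)
coeff-linearCombination N a p i = trans (coeff-sum {N} _ i)
  (sum-cong-≗ {N} (λ k → coeff-· (a (toℕ k)) (p (toℕ k)) i))

coeff-deriv : ∀ p i → coeff (deriv p) i ≡ ι (suc i) ℚ.* coeff p (suc i)
coeff-deriv []      i = sym (ℚ.*-zeroʳ (ι (suc i)))
coeff-deriv (a ∷ p) i = trans (coeff-derivFrom 1 p i) (cong (λ l → ι l ℚ.* coeff p i) (ℕ.+-comm i 1))
  where
  coeff-derivFrom : ∀ m q j → coeff (derivFrom m q) j ≡ ι (j ℕ.+ m) ℚ.* coeff q j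
  coeff-derivFrom m []      j       = sym (ℚ.*-zeroʳ (ι (j ℕ.+ m)))
  coeff-derivFrom m (b ∷ q) zero    = refl
  coeff-derivFrom m (b ∷ q) (suc j) = trans (coeff-derivFrom (suc m) q j)
    (cong (λ l → ι l ℚ.* coeff q j) (ℕ.+-suc j m))

-- Products of monic linear factors

-- The polynomial x + b as an explicit list. `X` is definitionally `linear 0ℚ`, so facts about
-- `linear` also cover multiplication by `X`.
linear : ℚ → Poly
linear b = b ∷ 1ℚ ∷ []

coeff-linear* : ∀ b p i →
  coeff (linear b * p) i ≡ b ℚ.* coeff p i ℚ.+ shift (coeff p) i
coeff-linear* b p i = trans (coeff-∷* b (const 1ℚ) p i)
  (cong (b ℚ.* coeff p i ℚ.+_)
    (shift-cong (λ j → trans (coeff-const* 1ℚ p j) (ℚ.*-identityˡ _)) i))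

coeff-X* : ∀ p i → coeff (X * p) i ≡ shift (coeff p) i
coeff-X* p i = trans (coeff-linear* 0ℚ p i)
  (trans (cong (ℚ._+ shift (coeff p) i) (ℚ.*-zeroˡ (coeff p i))) (ℚ.+-identityˡ _))

coeff-X*X* : ∀ p i → coeff (X * (X * p)) i ≡ shift (shift (coeff p)) i
coeff-X*X* p i = trans (coeff-X* (X * p) i) (shift-cong (coeff-X* p) i)

linear*-cong : ∀ b p q → p ≈ q → linear b * p ≈ linear b * q
linear*-cong b p q p≈q i = trans (coeff-linear* b p i)
  (trans (cong₂ (λ c d → b ℚ.* c ℚ.+ d) (p≈q i) (shift-cong p≈q i))
    (sym (coeff-linear* b q i)))

coeff-linear*linear* : ∀ a b p i →
  coeff (linear a * (linear b * p)) i
    ≡ a ℚ.* (b ℚ.* coeff p i ℚ.+ shift (coeff p) i)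
      ℚ.+ (b ℚ.* shift (coeff p) i ℚ.+ shift (shift (coeff p)) i)
coeff-linear*linear* a b p i = trans (coeff-linear* a (linear b * p) i)
  (cong₂ (λ c d → a ℚ.* c ℚ.+ d) (coeff-linear* b p i)
    (trans (shift-cong (coeff-linear* b p) i)
      (shift-linear b (coeff p) (shift (coeff p)) i)))

-- Both sides expand to the same combination of `p`, x `p` and x² `p`, symmetric in `a` and `b`.
linear*-comm : ∀ a b p → linear a * (linear b * p) ≈ linear b * (linear a * p)
linear*-comm a b p i = trans (coeff-linear*linear* a b p i)
  (trans
    (solve 5 (λ a b x y z →
      a :* (b :* x :+ y) :+ (b :* y :+ z) := b :* (a :* x :+ y) :+ (a :* y :+ z)) refl
      a b (coeff p i) (shift (coeff p) i) (shift (shift (coeff p)) i))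
    (sym (coeff-linear*linear* b a p i)))

-- x² = (x + h)(x - h) + h². With h = k/2 this is where the term k²/4 comes from.
difference-of-squares : ∀ h p i →
  coeff (X * (X * p)) i
    ≡ coeff (linear h * (linear (ℚ.- h) * p)) i ℚ.+ h ℚ.* h ℚ.* coeff p i
difference-of-squares h p i = trans (coeff-X*X* p i)
  (trans
    (solve 4 (λ h x y z →
      z := h :* (:- h :* x :+ y) :+ (:- h :* y :+ z) :+ h :* h :* x) refl
      h (coeff p i) (shift (coeff p) i) (shift (shift (coeff p)) i))
    (cong (ℚ._+ h ℚ.* h ℚ.* coeff p i)
      (sym (coeff-linear*linear* h (ℚ.- h) p i))))

linearProduct : (ℕ → ℚ) → ℕ → Poly
linearProduct b n = product {n} (λ i → linear (b (toℕ i)))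

linearProduct-cong : ∀ {b c} → b ≗ c → linearProduct b ≗ linearProduct c
linearProduct-cong b≗c zero    = refl
linearProduct-cong b≗c (suc n) =
  cong₂ (λ x p → linear x * p) (b≗c 0) (linearProduct-cong (b≗c ∘ suc) n)

-- `product` peels off its first factor, but x^[k+2] has an extra factor at each end of x^[k].
-- Commuting adjacent factors carries the last one to the front.
linearProduct-last : ∀ b n →
  linearProduct b (suc n) ≈ linear (b n) * linearProduct b n
linearProduct-last b zero    i = refl
linearProduct-last b (suc n) i = trans
  (linear*-cong (b 0) (linearProduct (b ∘ suc) (suc n))
    (linear (b (suc n)) * linearProduct (b ∘ suc) n)
    (linearProduct-last (b ∘ suc) n) i)
  (linear*-comm (b 0) (b (suc n)) (linearProduct (b ∘ suc) n) i)

-- Central factorials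

-- 0ℚ + … is what the constant term of X + const … evaluates to, so that
-- centralFactorial (suc m) is definitionally X * linearProduct (root (suc m)) m.
root : ℕ → ℕ → ℚ
root n i = 0ℚ ℚ.+ (+ n / 2 ℚ.- ι (suc i))

root-first : ∀ n → root (2 ℕ.+ n) 0 ≡ + n / 2
root-first n rewrite n/2≡½*n (2 ℕ.+ n) | n/2≡½*n n | ι-suc (suc n) | ι-suc n =
  solve 1 (λ x → con 0ℚ :+ (con ½ :* (con 1ℚ :+ (con 1ℚ :+ x)) :- con 1ℚ)
    := con ½ :* x) refl (ι n)

-- Raising n by 2 raises n/2 by 1, which cancels the advance of the index. Hence the factors of
-- x^[n] recur, in order, right after the first extra factor of x^[n+2].
root-suc : ∀ n i → root (2 ℕ.+ n) (suc i) ≡ root n i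
root-suc n i rewrite n/2≡½*n (2 ℕ.+ n) | n/2≡½*n n | ι-suc (suc n) | ι-suc n
                   | ι-suc (suc i) =
  solve 2 (λ x y → con 0ℚ :+ (con ½ :* (con 1ℚ :+ (con 1ℚ :+ x)) :- (con 1ℚ :+ y))
    := con 0ℚ :+ (con ½ :* x :- y)) refl (ι n) (ι (suc i))

-- Index `m` is one past the last factor of x^[m+1], so this constant belongs to the second extra
-- factor of x^[m+3].
root-last : ∀ m → root (suc m) m ≡ ℚ.- (+ suc m / 2)
root-last m rewrite n/2≡½*n (suc m) =
  solve 1 (λ x → con 0ℚ :+ (con ½ :* x :- x) := :- (con ½ :* x)) refl (ι (suc m))

centralFactorial-step : ∀ k i →
  coeff (X * (X * centralFactorial k)) i
    ≡ coeff (centralFactorial (2 ℕ.+ k)) i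
      ℚ.+ + k / 2 ℚ.* (+ k / 2) ℚ.* coeff (centralFactorial k) i
-- x^[0] = 1 lacks the leading factor x, so it is treated apart: x^[2] evaluates to x · x, and the
-- correction term is 0.
centralFactorial-step zero i = sym
  (trans (cong (coeff (centralFactorial 2) i ℚ.+_) (ℚ.*-zeroˡ (coeff (const 1ℚ) i)))
    (ℚ.+-identityʳ (coeff (centralFactorial 2) i)))
centralFactorial-step (suc m) i = begin
  coeff (X * (X * (X * p))) i
    ≡⟨ coeff-X* (X * (X * p)) i ⟩
  shift (coeff (X * (X * p))) i
    -- The leading factor x is kept outside as one `shift`; the difference of squares acts on the
    -- remaining product `p`.
    ≡⟨ shift-cong (λ j → trans (difference-of-squares h p j)
         (ℚ.+-comm (coeff (linear h * (linear (ℚ.- h) * p)) j) _)) i ⟩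
  shift (λ j → h ℚ.* h ℚ.* coeff p j ℚ.+ coeff (linear h * (linear (ℚ.- h) * p)) j) i
    ≡⟨ shift-linear (h ℚ.* h) (coeff p) (coeff (linear h * (linear (ℚ.- h) * p))) i ⟩
  h ℚ.* h ℚ.* shift (coeff p) i ℚ.+ shift (coeff (linear h * (linear (ℚ.- h) * p))) i
    ≡⟨ ℚ.+-comm (h ℚ.* h ℚ.* shift (coeff p) i) _ ⟩
  shift (coeff (linear h * (linear (ℚ.- h) * p))) i ℚ.+ h ℚ.* h ℚ.* shift (coeff p) i
    ≡⟨ cong₂ (λ x y → x ℚ.+ h ℚ.* h ℚ.* y)
         (trans (coeff-X* q i) (shift-cong extra-factors i)) (coeff-X* p i) ⟨
  coeff (X * q) i ℚ.+ h ℚ.* h ℚ.* coeff (X * p) i ∎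
  where
  h = + suc m / 2
  p = linearProduct (root (suc m)) m
  q = linearProduct (root (3 ℕ.+ m)) (2 ℕ.+ m)

  extra-factors : q ≈ linear h * (linear (ℚ.- h) * p)
  extra-factors j = begin
    coeff q j
      ≡⟨ cong₂ (λ x r → coeff (linear x * r) j) (root-first (suc m))
           (linearProduct-cong (root-suc (suc m)) (suc m)) ⟩
    coeff (linear h * linearProduct (root (suc m)) (suc m)) j
      ≡⟨ linear*-cong h (linearProduct (root (suc m)) (suc m))
           (linear (root (suc m) m) * p) (linearProduct-last (root (suc m)) m) j ⟩
    coeff (linear h * (linear (root (suc m) m) * p)) j
      ≡⟨ cong (λ x → coeff (linear h * (linear x * p)) j) (root-last m) ⟩
    coeff (linear h * (linear (ℚ.- h) * p)) j ∎

-- Trailing zeros make the list length useless as a degree, so the degree bound is expressed by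
-- vanishing coefficients.
IsMonic : ℕ → Poly → Set
IsMonic d p = coeff p d ≡ 1ℚ × (∀ {i} → d ℕ.< i → coeff p i ≡ 0ℚ)

linear*-monic : ∀ b p {d} → IsMonic d p → IsMonic (suc d) (linear b * p)
linear*-monic b p {d} (leading , above) = leading′ , above′
  where
  leading′ : coeff (linear b * p) (suc d) ≡ 1ℚ
  leading′ = trans (coeff-linear* b p (suc d))
    (trans (cong₂ (λ x y → b ℚ.* x ℚ.+ y) (above ℕ.≤-refl) leading)
      (solve 1 (λ b → b :* con 0ℚ :+ con 1ℚ := con 1ℚ) refl b))

  above′ : ∀ {i} → suc d ℕ.< i → coeff (linear b * p) i ≡ 0ℚ
  above′ {suc i} (s≤s d<i) = trans (coeff-linear* b p (suc i))
    (trans (cong₂ (λ x y → b ℚ.* x ℚ.+ y) (above (ℕ.m≤n⇒m≤1+n d<i)) (above d<i))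
      (solve 1 (λ b → b :* con 0ℚ :+ con 0ℚ := con 0ℚ) refl b))

const1-monic : IsMonic 0 (const 1ℚ)
const1-monic = refl , λ { {suc i} _ → refl }

linearProduct-monic : ∀ b n → IsMonic n (linearProduct b n)
linearProduct-monic b zero    = const1-monic
linearProduct-monic b (suc n) =
  linear*-monic (b 0) (linearProduct (b ∘ suc) n) (linearProduct-monic (b ∘ suc) n)

centralFactorial-monic : ∀ n → IsMonic n (centralFactorial n)
centralFactorial-monic zero    = const1-monic
centralFactorial-monic (suc m) =
  linear*-monic 0ℚ (linearProduct (root (suc m)) m) (linearProduct-monic (root (suc m)) m)

-- Expansions in the basis of central factorials

sum-snoc : ∀ N (g : ℕ → ℚ) →
  sumℚ {suc N} (g ∘ toℕ) ≡ sumℚ {N} (g ∘ toℕ) ℚ.+ g N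
sum-snoc N g = trans (sum-init-last {N} (g ∘ toℕ))
  (cong₂ ℚ._+_ (sum-cong-≗ {N} (λ k → cong g (toℕ-inject₁ k))) (cong g (toℕ-fromℕ N)))

expand : ℕ → (ℕ → ℚ) → ℕ → ℚ
expand N a i = sumℚ {N} (λ k → a (toℕ k) ℚ.* coeff (centralFactorial (toℕ k)) i)

expand-snoc : ∀ N a i →
  expand (suc N) a i ≡ expand N a i ℚ.+ a N ℚ.* coeff (centralFactorial N) i
expand-snoc N a i = sum-snoc N (λ k → a k ℚ.* coeff (centralFactorial k) i)

-- Padding with zero weights brings expansions of different lengths to a common number of terms.
expand-snoc-zero : ∀ N a i → a N ≡ 0ℚ → expand (suc N) a i ≡ expand N a i
expand-snoc-zero N a i aN≡0 = begin
  expand (suc N) a i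
    ≡⟨ expand-snoc N a i ⟩
  expand N a i ℚ.+ a N ℚ.* coeff (centralFactorial N) i
    ≡⟨ cong (λ x → expand N a i ℚ.+ x ℚ.* coeff (centralFactorial N) i) aN≡0 ⟩
  expand N a i ℚ.+ 0ℚ ℚ.* coeff (centralFactorial N) i
    ≡⟨ cong (expand N a i ℚ.+_) (ℚ.*-zeroˡ (coeff (centralFactorial N) i)) ⟩
  expand N a i ℚ.+ 0ℚ
    ≡⟨ ℚ.+-identityʳ (expand N a i) ⟩
  expand N a i ∎

-- Only x^[k] with k < N occur, and each has degree k.
expand-above : ∀ N a {i} → N ≤ i → expand N a i ≡ 0ℚ
expand-above zero    a     _   = refl
expand-above (suc N) a {i} N<i = begin
  expand (suc N) a i
    ≡⟨ expand-snoc N a i ⟩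
  expand N a i ℚ.+ a N ℚ.* coeff (centralFactorial N) i
    ≡⟨ cong₂ (λ x y → x ℚ.+ a N ℚ.* y) (expand-above N a (ℕ.<⇒≤ N<i))
         (proj₂ (centralFactorial-monic N) N<i) ⟩
  0ℚ ℚ.+ a N ℚ.* 0ℚ
    ≡⟨ trans (ℚ.+-identityˡ (a N ℚ.* 0ℚ)) (ℚ.*-zeroʳ (a N)) ⟩
  0ℚ ∎

expand-top : ∀ N a → expand (suc N) a N ≡ a N
expand-top N a = begin
  expand (suc N) a N
    ≡⟨ expand-snoc N a N ⟩
  expand N a N ℚ.+ a N ℚ.* coeff (centralFactorial N) N
    ≡⟨ cong₂ (λ x y → x ℚ.+ a N ℚ.* y) (expand-above N a ℕ.≤-refl)
         (proj₁ (centralFactorial-monic N)) ⟩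
  0ℚ ℚ.+ a N ℚ.* 1ℚ
    ≡⟨ trans (ℚ.+-identityˡ (a N ℚ.* 1ℚ)) (ℚ.*-identityʳ (a N)) ⟩
  a N ∎

-- Linear independence by triangularity: the top coefficient of the sum is the weight of the last
-- central factorial, so the last terms agree and cancel, and the shorter sums are compared by
-- induction.
expand-injective : ∀ N a b → expand N a ≗ expand N b → ∀ {k} → k ℕ.< N → a k ≡ b k
expand-injective (suc N) a b eq {k} (s≤s k≤N) with ℕ.m≤n⇒m<n∨m≡n k≤N
... | inj₂ refl = trans (sym (expand-top k a)) (trans (eq k) (expand-top k b))
... | inj₁ k<N  = expand-injective N a b lower k<N
  where
  aN≡bN : a N ≡ b N
  aN≡bN = trans (sym (expand-top N a)) (trans (eq N) (expand-top N b))

  lower : expand N a ≗ expand N b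
  lower i = ∙-cancelʳ ℚ.+-0-abelianGroup (b N ℚ.* coeff (centralFactorial N) i) _ _
    (begin
      expand N a i ℚ.+ b N ℚ.* coeff (centralFactorial N) i
        ≡⟨ cong (λ x → expand N a i ℚ.+ x ℚ.* coeff (centralFactorial N) i) aN≡bN ⟨
      expand N a i ℚ.+ a N ℚ.* coeff (centralFactorial N) i
        ≡⟨ expand-snoc N a i ⟨
      expand (suc N) a i
        ≡⟨ eq i ⟩
      expand (suc N) b i
        ≡⟨ expand-snoc N b i ⟩
      expand N b i ℚ.+ b N ℚ.* coeff (centralFactorial N) i ∎)

expand-+ : ∀ N a b i →
  expand N (λ k → a k ℚ.+ b k) i ≡ expand N a i ℚ.+ expand N b i
expand-+ N a b i = trans
  (sum-cong-≗ {N} (λ k → ℚ.*-distribʳ-+ (coeff (centralFactorial (toℕ k)) i) (a (toℕ k)) (b (toℕ k))))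
  (∑-distrib-+ {N} (λ k → a (toℕ k) ℚ.* coeff (centralFactorial (toℕ k)) i)
    (λ k → b (toℕ k) ℚ.* coeff (centralFactorial (toℕ k)) i))

expand-shift² : ∀ N a i →
  expand (2 ℕ.+ N) (shift (shift a)) i
    ≡ sumℚ {N} (λ k → a (toℕ k) ℚ.* coeff (centralFactorial (2 ℕ.+ toℕ k)) i)
expand-shift² N a i = trans
  (cong₂ (λ x y → x ℚ.+ (y ℚ.+ s)) (ℚ.*-zeroˡ (coeff (centralFactorial 0) i))
    (ℚ.*-zeroˡ (coeff (centralFactorial 1) i)))
  (trans (ℚ.+-identityˡ (0ℚ ℚ.+ s)) (ℚ.+-identityˡ s))
  where
  s = sumℚ {N} (λ k → a (toℕ k) ℚ.* coeff (centralFactorial (2 ℕ.+ toℕ k)) i)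

-- Multiplication by x² in the basis of central factorials: by `centralFactorial-step` the weight at
-- k moves to k + 2 and also stays at k, scaled by k²/4.
shift²-expand : ∀ N a i →
  shift (shift (expand N a)) i
    ≡ expand (2 ℕ.+ N) (shift (shift a)) i
      ℚ.+ expand N (λ k → + k / 2 ℚ.* (+ k / 2) ℚ.* a k) i
shift²-expand N a i = begin
  shift (shift (expand N a)) i
    ≡⟨ shift-cong (shift-sum {N} (λ k → λ j → a (toℕ k) ℚ.* cf k j)) i ⟩
  shift (λ j → sumℚ {N} (λ k → shift (λ l → a (toℕ k) ℚ.* cf k l) j)) i
    ≡⟨ shift-sum {N} (λ k → shift (λ l → a (toℕ k) ℚ.* cf k l)) i ⟩
  sumℚ {N} (λ k → shift (shift (λ l → a (toℕ k) ℚ.* cf k l)) i)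
    ≡⟨ sum-cong-≗ {N} term ⟩
  sumℚ {N} (λ k → a (toℕ k) ℚ.* coeff (centralFactorial (2 ℕ.+ toℕ k)) i
    ℚ.+ h (toℕ k) ℚ.* h (toℕ k) ℚ.* a (toℕ k) ℚ.* cf k i)
    ≡⟨ ∑-distrib-+ {N} (λ k → a (toℕ k) ℚ.* coeff (centralFactorial (2 ℕ.+ toℕ k)) i) _ ⟩
  sumℚ {N} (λ k → a (toℕ k) ℚ.* coeff (centralFactorial (2 ℕ.+ toℕ k)) i)
    ℚ.+ expand N (λ k → h k ℚ.* h k ℚ.* a k) i
    ≡⟨ cong (ℚ._+ expand N (λ k → h k ℚ.* h k ℚ.* a k) i) (expand-shift² N a i) ⟨
  expand (2 ℕ.+ N) (shift (shift a)) i ℚ.+ expand N (λ k → h k ℚ.* h k ℚ.* a k) i ∎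
  where
  h : ℕ → ℚ
  h k = + k / 2

  cf : Fin N → ℕ → ℚ
  cf k = coeff (centralFactorial (toℕ k))

  term : ∀ k → shift (shift (λ l → a (toℕ k) ℚ.* cf k l)) i
    ≡ a (toℕ k) ℚ.* coeff (centralFactorial (2 ℕ.+ toℕ k)) i
      ℚ.+ h (toℕ k) ℚ.* h (toℕ k) ℚ.* a (toℕ k) ℚ.* cf k i
  term k = begin
    shift (shift (λ l → a (toℕ k) ℚ.* cf k l)) i
      ≡⟨ shift-cong (shift-* (a (toℕ k)) (cf k)) i ⟩
    shift (λ l → a (toℕ k) ℚ.* shift (cf k) l) i
      ≡⟨ shift-* (a (toℕ k)) (shift (cf k)) i ⟩
    a (toℕ k) ℚ.* shift (shift (cf k)) i
      ≡⟨ cong (a (toℕ k) ℚ.*_) (trans (sym (coeff-X*X* (centralFactorial (toℕ k)) i))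
           (centralFactorial-step (toℕ k) i)) ⟩
    a (toℕ k) ℚ.* (coeff (centralFactorial (2 ℕ.+ toℕ k)) i
      ℚ.+ h (toℕ k) ℚ.* h (toℕ k) ℚ.* cf k i)
      ≡⟨ solve 4 (λ a c h d → a :* (c :+ h :* h :* d) := a :* c :+ h :* h :* a :* d) refl
           (a (toℕ k)) (coeff (centralFactorial (2 ℕ.+ toℕ k)) i) (h (toℕ k)) (cf k i) ⟩
    a (toℕ k) ℚ.* coeff (centralFactorial (2 ℕ.+ toℕ k)) i
      ℚ.+ h (toℕ k) ℚ.* h (toℕ k) ℚ.* a (toℕ k) ℚ.* cf k i ∎

-- Central Fubini-like polynomials

-- The vanishing hypothesis settles i ≥ N, where no power of x contributes. The induction splits off
-- the constant term and divides the rest by x.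
coeff-∑X^ : ∀ N (a : ℕ → ℚ) → (∀ {k} → N ≤ k → a k ≡ 0ℚ) → ∀ i →
  sumℚ {N} (λ k → a (toℕ k) ℚ.* coeff (X ^ toℕ k) i) ≡ a i
coeff-∑X^ zero    a a≡0 i       = sym (a≡0 z≤n)
coeff-∑X^ (suc N) a a≡0 zero    = begin
  a 0 ℚ.* 1ℚ ℚ.+ sumℚ {N} (λ k → a (suc (toℕ k)) ℚ.* coeff (X * X ^ toℕ k) 0)
    ≡⟨ cong₂ ℚ._+_ (ℚ.*-identityʳ (a 0)) (sum-cong-≗ {N} (λ k →
         trans (cong (a (suc (toℕ k)) ℚ.*_) (coeff-X* (X ^ toℕ k) 0))
           (ℚ.*-zeroʳ (a (suc (toℕ k)))))) ⟩
  a 0 ℚ.+ sumℚ {N} (λ _ → 0ℚ)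
    ≡⟨ cong (a 0 ℚ.+_) (sum-replicate-zero N) ⟩
  a 0 ℚ.+ 0ℚ
    ≡⟨ ℚ.+-identityʳ (a 0) ⟩
  a 0 ∎
coeff-∑X^ (suc N) a a≡0 (suc i) = begin
  a 0 ℚ.* 0ℚ ℚ.+ sumℚ {N} (λ k → a (suc (toℕ k)) ℚ.* coeff (X * X ^ toℕ k) (suc i))
    ≡⟨ cong₂ ℚ._+_ (ℚ.*-zeroʳ (a 0)) (sum-cong-≗ {N} (λ k →
         cong (a (suc (toℕ k)) ℚ.*_) (coeff-X* (X ^ toℕ k) (suc i)))) ⟩
  0ℚ ℚ.+ sumℚ {N} (λ k → a (suc (toℕ k)) ℚ.* coeff (X ^ toℕ k) i)
    ≡⟨ ℚ.+-identityˡ _ ⟩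
  sumℚ {N} (λ k → a (suc (toℕ k)) ℚ.* coeff (X ^ toℕ k) i)
    ≡⟨ coeff-∑X^ N (a ∘ suc) (λ N≤k → a≡0 (s≤s N≤k)) i ⟩
  a (suc i) ∎

module _ {T : ℕ → ℕ → ℚ} (isT : IsCentralFactorialNumbers T) where
  open IsCentralFactorialNumbers isT

  coeff-X^ : ∀ n i → coeff (X ^ n) i ≡ expand (suc n) (T n) i
  coeff-X^ n i = trans (expansion n i)
    (coeff-linearCombination (suc n) (T n) centralFactorial i)

  -- The double `shift` encodes T(m, k-2), with the default 0 for k < 2.
  T-recurrence : ∀ m k →
    T (2 ℕ.+ m) k ≡ shift (shift (T m)) k ℚ.+ + k / 2 ℚ.* (+ k / 2) ℚ.* T m k
  -- The expansion of x^(m+2) has m + 3 terms and so determines weights only for k < m + 3; beyond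
  -- that both sides vanish.
  T-recurrence m k with k ℕ.<? 3 ℕ.+ m
  ... | yes k<3+m = expand-injective (3 ℕ.+ m) (T (2 ℕ.+ m))
    (λ j → shift (shift (T m)) j ℚ.+ + j / 2 ℚ.* (+ j / 2) ℚ.* T m j) same-expansion k<3+m
    where
    h²T : ℕ → ℚ
    h²T j = + j / 2 ℚ.* (+ j / 2) ℚ.* T m j

    h²T-vanishing : ∀ {j} → m ℕ.< j → h²T j ≡ 0ℚ
    h²T-vanishing {j} m<j = trans (cong (+ j / 2 ℚ.* (+ j / 2) ℚ.*_) (vanishing m<j))
      (ℚ.*-zeroʳ (+ j / 2 ℚ.* (+ j / 2)))

    same-expansion : ∀ i → expand (3 ℕ.+ m) (T (2 ℕ.+ m)) i
      ≡ expand (3 ℕ.+ m) (λ j → shift (shift (T m)) j ℚ.+ h²T j) i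
    same-expansion i = begin
      expand (3 ℕ.+ m) (T (2 ℕ.+ m)) i
        ≡⟨ coeff-X^ (2 ℕ.+ m) i ⟨
      coeff (X * (X * X ^ m)) i
        ≡⟨ coeff-X*X* (X ^ m) i ⟩
      shift (shift (coeff (X ^ m))) i
        ≡⟨ shift-cong (shift-cong (coeff-X^ m)) i ⟩
      shift (shift (expand (1 ℕ.+ m) (T m))) i
        ≡⟨ shift²-expand (1 ℕ.+ m) (T m) i ⟩
      expand (3 ℕ.+ m) (shift (shift (T m))) i ℚ.+ expand (1 ℕ.+ m) h²T i
        -- The second sum has m + 1 terms; its weights at m + 1 and m + 2 are 0, so it may be
        -- lengthened to m + 3 terms.
        ≡⟨ cong (expand (3 ℕ.+ m) (shift (shift (T m))) i ℚ.+_)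
             (trans
               (expand-snoc-zero (2 ℕ.+ m) h²T i (h²T-vanishing (ℕ.m≤n⇒m≤1+n ℕ.≤-refl)))
               (expand-snoc-zero (1 ℕ.+ m) h²T i (h²T-vanishing ℕ.≤-refl))) ⟨
      expand (3 ℕ.+ m) (shift (shift (T m))) i ℚ.+ expand (3 ℕ.+ m) h²T i
        ≡⟨ expand-+ (3 ℕ.+ m) (shift (shift (T m))) h²T i ⟨
      expand (3 ℕ.+ m) (λ j → shift (shift (T m)) j ℚ.+ h²T j) i ∎
  ... | no k≮3+m with ℕ.≮⇒≥ k≮3+m
  -- Writing k = j + 2 lets the double `shift` compute to `T m j`, which vanishes as m < j.
  ...   | s≤s (s≤s {n = j} m<j) = begin
    T (2 ℕ.+ m) (2 ℕ.+ j)
      ≡⟨ vanishing (s≤s (s≤s m<j)) ⟩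
    0ℚ
      ≡⟨ trans (ℚ.+-identityˡ _) (ℚ.*-zeroʳ (h ℚ.* h)) ⟨
    0ℚ ℚ.+ h ℚ.* h ℚ.* 0ℚ
      ≡⟨ cong₂ (λ x y → x ℚ.+ h ℚ.* h ℚ.* y) (vanishing m<j)
           (vanishing (ℕ.m≤n⇒m≤1+n (ℕ.m≤n⇒m≤1+n m<j))) ⟨
    T m j ℚ.+ h ℚ.* h ℚ.* T m (2 ℕ.+ j) ∎
    where h = + (2 ℕ.+ j) / 2

  coeff-centralFubini : ∀ n i → coeff (centralFubini T n) i ≡ ι (i !) ℚ.* T n i
  coeff-centralFubini n i = trans
    (coeff-linearCombination (suc n) c (X ^_) i)
    (coeff-∑X^ (suc n) c (λ {k} n<k →
      trans (cong (ι (k !) ℚ.*_) (vanishing n<k)) (ℚ.*-zeroʳ (ι (k !)))) i)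
    where
    c : ℕ → ℚ
    c k = ι (k !) ℚ.* T n k

  -- The recurrence for T multiplied by i!. With i = j + 2, splitting i! = (j+2)(j+1) j! turns T(m,
  -- j) into a coefficient of the polynomial for `m`.
  coeff-centralFubini-recurrence : ∀ m i → let c = coeff (centralFubini T m) in
    coeff (centralFubini T (2 ℕ.+ m)) i
      ≡ shift (shift (λ j → ι (suc j) ℚ.* ι (2 ℕ.+ j) ℚ.* c j)) i
        ℚ.+ + i / 2 ℚ.* (+ i / 2) ℚ.* c i
  coeff-centralFubini-recurrence m i = begin
    coeff (centralFubini T (2 ℕ.+ m)) i
      ≡⟨ coeff-centralFubini (2 ℕ.+ m) i ⟩
    ι (i !) ℚ.* T (2 ℕ.+ m) i
      ≡⟨ cong (ι (i !) ℚ.*_) (T-recurrence m i) ⟩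
    ι (i !) ℚ.* (shift (shift (T m)) i ℚ.+ h ℚ.* h ℚ.* T m i)
      ≡⟨ solve 4 (λ a b h t → a :* (b :+ h :* h :* t) := a :* b :+ h :* h :* (a :* t)) refl
           (ι (i !)) (shift (shift (T m)) i) h (T m i) ⟩
    ι (i !) ℚ.* shift (shift (T m)) i ℚ.+ h ℚ.* h ℚ.* (ι (i !) ℚ.* T m i)
      ≡⟨ cong₂ (λ x y → x ℚ.+ h ℚ.* h ℚ.* y) (factorial-shift i)
           (sym (coeff-centralFubini m i)) ⟩
    shift (shift (λ j → ι (suc j) ℚ.* ι (2 ℕ.+ j) ℚ.* coeff (centralFubini T m) j)) i
      ℚ.+ h ℚ.* h ℚ.* coeff (centralFubini T m) i ∎
    where
    h = + i / 2

    factorial-shift : ∀ i → ι (i !) ℚ.* shift (shift (T m)) i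
      ≡ shift (shift (λ j → ι (suc j) ℚ.* ι (2 ℕ.+ j) ℚ.* coeff (centralFubini T m) j)) i
    factorial-shift zero          = ℚ.*-zeroʳ (ι 1)
    factorial-shift (suc zero)    = ℚ.*-zeroʳ (ι 1)
    factorial-shift (suc (suc j)) = begin
      ι ((2 ℕ.+ j) !) ℚ.* T m j
        ≡⟨ cong (ℚ._* T m j) (trans (ι-* (2 ℕ.+ j) (suc j !))
             (cong (ι (2 ℕ.+ j) ℚ.*_) (ι-* (suc j) (j !)))) ⟩
      ι (2 ℕ.+ j) ℚ.* (ι (suc j) ℚ.* ι (j !)) ℚ.* T m j
        ≡⟨ solve 4 (λ a b f t → a :* (b :* f) :* t := b :* a :* (f :* t)) refl
             (ι (2 ℕ.+ j)) (ι (suc j)) (ι (j !)) (T m j) ⟩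
      ι (suc j) ℚ.* ι (2 ℕ.+ j) ℚ.* (ι (j !) ℚ.* T m j)
        ≡⟨ cong (ι (suc j) ℚ.* ι (2 ℕ.+ j) ℚ.*_) (coeff-centralFubini m j) ⟨
      ι (suc j) ℚ.* ι (2 ℕ.+ j) ℚ.* coeff (centralFubini T m) j ∎

-- The differential operator on coefficients

coeff-aX²* : ∀ a q i →
  coeff ((0ℚ ∷ 0ℚ ∷ a ∷ []) * q) i ≡ shift (shift (λ j → a ℚ.* coeff q j)) i
coeff-aX²* a q i = trans (coeff-0∷* (0ℚ ∷ a ∷ []) q i)
  (shift-cong (λ j → trans (coeff-0∷* (const a) q j)
    (shift-cong (coeff-const* a q) j)) i)

coeff-[bX+dX³]* : ∀ b d q i →
  coeff ((0ℚ ∷ b ∷ 0ℚ ∷ d ∷ []) * q) i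
    ≡ shift (λ j → b ℚ.* coeff q j ℚ.+ shift (shift (λ l → d ℚ.* coeff q l)) j) i
coeff-[bX+dX³]* b d q i = trans (coeff-0∷* (b ∷ 0ℚ ∷ d ∷ []) q i)
  (shift-cong (λ j → trans (coeff-∷* b (0ℚ ∷ d ∷ []) q j)
    (cong (b ℚ.* coeff q j ℚ.+_) (trans
      (sym (coeff-0∷* (0ℚ ∷ d ∷ []) q j)) (coeff-aX²* d q j)))) i)

coeff-[bX²+dX⁴]* : ∀ b d q i →
  coeff ((0ℚ ∷ 0ℚ ∷ b ∷ 0ℚ ∷ d ∷ []) * q) i
    ≡ shift (shift (λ j → b ℚ.* coeff q j ℚ.+ shift (shift (λ l → d ℚ.* coeff q l)) j)) i
coeff-[bX²+dX⁴]* b d q i = trans (coeff-0∷* (0ℚ ∷ b ∷ 0ℚ ∷ d ∷ []) q i)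
  (shift-cong (coeff-[bX+dX³]* b d q) i)

coeff-deriv² : ∀ p i →
  coeff (deriv (deriv p)) i ≡ ι (suc i) ℚ.* (ι (2 ℕ.+ i) ℚ.* coeff p (2 ℕ.+ i))
coeff-deriv² p i = trans (coeff-deriv (deriv p) i)
  (cong (ι (suc i) ℚ.*_) (coeff-deriv p (suc i)))

-- The Euler operator x d/dx scales the coefficient of x^i by i; at i = 0 this factor 0 matches the
-- default of `shift`.
shift-deriv : ∀ d p i →
  shift (λ j → d ℚ.* coeff (deriv p) j) i ≡ d ℚ.* (ι i ℚ.* coeff p i)
shift-deriv d p zero    =
  solve 2 (λ d x → con 0ℚ := d :* (con 0ℚ :* x)) refl d (coeff p 0)
shift-deriv d p (suc i) = cong (d ℚ.*_) (coeff-deriv p i)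

-- The operator x² d²/dx² scales the coefficient of x^i by i(i-1). Subtracting in ℚ gives one
-- formula for all i, whose zeros at 0 and 1 match the defaults of `shift`.
shift²-deriv² : ∀ d p i →
  shift (shift (λ j → d ℚ.* coeff (deriv (deriv p)) j)) i
    ≡ d ℚ.* ((ι i ℚ.- 1ℚ) ℚ.* (ι i ℚ.* coeff p i))
shift²-deriv² d p zero          =
  solve 2 (λ d x → con 0ℚ := d :* ((con 0ℚ :- con 1ℚ) :* (con 0ℚ :* x))) refl
    d (coeff p 0)
shift²-deriv² d p (suc zero)    =
  solve 2 (λ d x → con 0ℚ := d :* ((con 1ℚ :- con 1ℚ) :* (con 1ℚ :* x))) refl
    d (coeff p 1)
shift²-deriv² d p (suc (suc i)) = cong (d ℚ.*_) (trans (coeff-deriv² p i)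
  (cong (ℚ._* (ι (2 ℕ.+ i) ℚ.* coeff p (2 ℕ.+ i))) suc-1))
  where
  suc-1 : ι (suc i) ≡ ι (2 ℕ.+ i) ℚ.- 1ℚ
  suc-1 = trans (solve 1 (λ x → x := con 1ℚ :+ x :- con 1ℚ) refl (ι (suc i)))
    (cong (ℚ._- 1ℚ) (sym (ι-suc (suc i))))

operator : Poly → Poly
operator p = (+ 2 / 1) · X ^ 2 * p
  + ((+ 1 / 4) · X + (+ 4 / 1) · X ^ 3) * deriv p
  + ((+ 1 / 4) · X ^ 2 + X ^ 4) * deriv (deriv p)

-- Terms are grouped by their effect on the degree. Those preserving it give i/4 + i(i-1)/4 = i²/4;
-- those raising it from j to j + 2 give 2 + 4j + j(j-1) = (j+1)(j+2).
coeff-operator : ∀ p i →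
  coeff (operator p) i
    ≡ shift (shift (λ j → ι (suc j) ℚ.* ι (2 ℕ.+ j) ℚ.* coeff p j)) i
      ℚ.+ + i / 2 ℚ.* (+ i / 2) ℚ.* coeff p i
coeff-operator p i = trans (split i) (combine i)
  where
  ¼ = + 1 / 4
  c = coeff p
  c′ = coeff (deriv p)
  c″ = coeff (deriv (deriv p))

  A B C : ℕ → ℚ
  A = shift (shift (λ j → ι 2 ℚ.* c j))
  B = shift (λ j → ¼ ℚ.* c′ j ℚ.+ shift (shift (λ l → ι 4 ℚ.* c′ l)) j)
  C = shift (shift (λ j → ¼ ℚ.* c″ j ℚ.+ shift (shift (λ l → 1ℚ ℚ.* c″ l)) j))

  split : ∀ i → coeff (operator p) i ≡ A i ℚ.+ B i ℚ.+ C i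
  -- The multipliers in `operator` are closed and evaluate to the lists `a`, `b` and `d`.
  split i = trans (coeff-+ (a * p + b * deriv p) (d * deriv (deriv p)) i)
    (cong₂ ℚ._+_
      (trans (coeff-+ (a * p) (b * deriv p) i)
        (cong₂ ℚ._+_ (coeff-aX²* (ι 2) p i) (coeff-[bX+dX³]* ¼ (ι 4) (deriv p) i)))
      (coeff-[bX²+dX⁴]* ¼ 1ℚ (deriv (deriv p)) i))
    where
    a = 0ℚ ∷ 0ℚ ∷ ι 2 ∷ []
    b = 0ℚ ∷ ¼ ∷ 0ℚ ∷ ι 4 ∷ []
    d = 0ℚ ∷ 0ℚ ∷ ¼ ∷ 0ℚ ∷ 1ℚ ∷ []

  combine : ∀ i → A i ℚ.+ B i ℚ.+ C i
    ≡ shift (shift (λ j → ι (suc j) ℚ.* ι (2 ℕ.+ j) ℚ.* c j)) i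
      ℚ.+ + i / 2 ℚ.* (+ i / 2) ℚ.* c i
  combine zero          = sym (trans (ℚ.+-identityˡ (0ℚ ℚ.* c 0)) (ℚ.*-zeroˡ (c 0)))
  -- At i = 1 only (x/4) p′ contributes.
  combine (suc zero)    = trans
    (cong (λ x → 0ℚ ℚ.+ (¼ ℚ.* x ℚ.+ 0ℚ) ℚ.+ 0ℚ) (coeff-deriv p 0))
    (solve 1 (λ x →
      con 0ℚ :+ (con ¼ :* (con 1ℚ :* x) :+ con 0ℚ) :+ con 0ℚ
        := con 0ℚ :+ con ½ :* con ½ :* x) refl (c 1))
  combine (suc (suc j)) = begin
    ι 2 ℚ.* c j
      ℚ.+ (¼ ℚ.* c′ (suc j) ℚ.+ shift (λ l → ι 4 ℚ.* c′ l) j)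
      ℚ.+ (¼ ℚ.* c″ j ℚ.+ shift (shift (λ l → 1ℚ ℚ.* c″ l)) j)
      -- With x² taken off, 4x³p′ and x⁴p″ leave 4xp′ and x²p″ at index j, which the two scaling
      -- lemmas evaluate.
      ≡⟨ cong₂ (λ x y → ι 2 ℚ.* c j ℚ.+ x ℚ.+ y)
           (cong₂ (λ x y → ¼ ℚ.* x ℚ.+ y) (coeff-deriv p (suc j)) (shift-deriv (ι 4) p j))
           (cong₂ (λ x y → ¼ ℚ.* x ℚ.+ y) (coeff-deriv² p j) (shift²-deriv² 1ℚ p j)) ⟩
    ι 2 ℚ.* c j
      ℚ.+ (¼ ℚ.* (ι (2 ℕ.+ j) ℚ.* c (2 ℕ.+ j)) ℚ.+ ι 4 ℚ.* (ι j ℚ.* c j))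
      ℚ.+ (¼ ℚ.* (ι (suc j) ℚ.* (ι (2 ℕ.+ j) ℚ.* c (2 ℕ.+ j)))
           ℚ.+ 1ℚ ℚ.* ((ι j ℚ.- 1ℚ) ℚ.* (ι j ℚ.* c j)))
      ≡⟨ collect {ι j} (ι-suc j) (ι-suc (suc j)) (n/2≡½*n (2 ℕ.+ j)) ⟩
    ι (suc j) ℚ.* ι (2 ℕ.+ j) ℚ.* c j
      ℚ.+ + (2 ℕ.+ j) / 2 ℚ.* (+ (2 ℕ.+ j) / 2) ℚ.* c (2 ℕ.+ j) ∎
    where
    -- Numerals become variables so that matching on `refl` substitutes them; what is left is a
    -- polynomial identity in j and the coefficients at j and j + 2.
    collect : ∀ {x x₁ x₂ h y z : ℚ} → x₁ ≡ 1ℚ ℚ.+ x → x₂ ≡ 1ℚ ℚ.+ x₁ → h ≡ ½ ℚ.* x₂ →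
      ι 2 ℚ.* y
        ℚ.+ (¼ ℚ.* (x₂ ℚ.* z) ℚ.+ ι 4 ℚ.* (x ℚ.* y))
        ℚ.+ (¼ ℚ.* (x₁ ℚ.* (x₂ ℚ.* z)) ℚ.+ 1ℚ ℚ.* ((x ℚ.- 1ℚ) ℚ.* (x ℚ.* y)))
      ≡ x₁ ℚ.* x₂ ℚ.* y ℚ.+ h ℚ.* h ℚ.* z
    collect {x} {y = y} {z = z} refl refl refl = solve 3 (λ x y z →
      let x₁ = con 1ℚ :+ x; x₂ = con 1ℚ :+ x₁; h = con ½ :* x₂ in
      con (ι 2) :* y
        :+ (con ¼ :* (x₂ :* z) :+ con (ι 4) :* (x :* y))
        :+ (con ¼ :* (x₁ :* (x₂ :* z)) :+ con 1ℚ :* ((x :- con 1ℚ) :* (x :* y)))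
      := x₁ :* x₂ :* y :+ h :* h :* z) refl x y z

theorem6 : (T : ℕ → ℕ → ℚ) → IsCentralFactorialNumbers T →
    ∀ n → 2 ≤ n →
    let ℭ = centralFubini T (n ∸ 2) in
    centralFubini T n
    ≈ (+ 2 / 1) · X ^ 2 * ℭ
    + ((+ 1 / 4) · X + (+ 4 / 1) · X ^ 3) * deriv ℭ
    + ((+ 1 / 4) · X ^ 2 + X ^ 4) * deriv (deriv ℭ)
theorem6 T isT (suc (suc m)) (s≤s (s≤s z≤n)) i =
  trans (coeff-centralFubini-recurrence isT m i) (sym (coeff-operator (centralFubini T m) i))
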